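{- For every integer $k\ge 6$, we have $r_k(k+1,k+1)> s_3\left(\lfloor k/2\rfloor-2\right)$.
   Context: Write $[n]=\{1,\dots,n\}$ and let $\binom{[N]}{k}$ denote the set of $k$-element subsets of $[N]$. The Ramsey number $r_k(s,m)$ is the smallest integer $N$ such that every red/blue coloring of the $k$-subsets of $[N]$ contains either an $s$-element subset of $[N]$ all of whose $k$-subsets are red or an $m$-element subset of $[N]$ all of whose $k$-subsets are blue. For integers $N,k\ge 1$, the shift graph $\operatorname{Sh}(N,k)$ is the directed graph with vertex set $\binom{[N]}{k}$ in which, for all $x_1<x_2<\cdots<x_{k+1}$ in $[N]$, there is an arc $\{x_1,\ldots,x_k\}\to\{x_2,\ldots,x_{k+1}\}$ (and no other arcs). Its chromatic number $\chi(\operatorname{Sh}(N,k))$ is that of the underlying undirected graph. The $3$-color shift number is $s_3(k)=\max\{N:\chi(\operatorname{Sh}(N,k))\le 3\}$ (this maximum exists, since for fixed $k$ Ramsey's theorem gives $\chi(\operatorname{Sh}(N,k))\to\infty$ as $N\to\infty$). -}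

module Defs where

open import Data.Fin.Base using (Fin; suc; inject₁; _<_)
open import Data.Fin.Subset using (Subset; _∈_; _⊆_; ∣_∣)
open import Data.Nat.Base using (ℕ; suc; _≤_)
open import Data.Product.Base using (Σ; ∃; ∃-syntax; _×_; proj₁)
open import Data.Sum.Base using (_⊎_)
open import Function.Bundles using (_⇔_)
open import Relation.Binary.Core using (_Preserves_⟶_)
open import Relation.Binary.PropositionalEquality.Core using (_≡_; _≢_)

IsLeast : (ℕ → Set) → ℕ → Set
IsLeast P n = P n × (∀ m → P m → n ≤ m)

IsGreatest : (ℕ → Set) → ℕ → Set
IsGreatest P n = P n × (∀ m → P m → m ≤ n)

-- The ground set {1,…,N} is represented by Fin N, with the same order.
KSubset : ℕ → ℕ → Set
KSubset N k = Σ (Subset N) λ A → ∣ A ∣ ≡ k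

data Colour : Set where
  red blue : Colour

Monochromatic : ∀ {N k} → (KSubset N k → Colour) → Colour → Subset N → Set
Monochromatic {N} {k} c col A = (e : KSubset N k) → proj₁ e ⊆ A → c e ≡ col

RamseyProperty : (k s m N : ℕ) → Set
RamseyProperty k s m N = (c : KSubset N k → Colour) →
    (∃[ A ] ∣ A ∣ ≡ s × Monochromatic c red A)
  ⊎ (∃[ A ] ∣ A ∣ ≡ m × Monochromatic c blue A)

-- r = r_k(s,m), stated as a functional relation: r is determined
-- uniquely, and it exists by Ramsey's theorem.
IsRamseyNumber : (k s m r : ℕ) → Set
IsRamseyNumber k s m = IsLeast (RamseyProperty k s m)

record Digraph : Set₁ where
  field
    Vertex : Set
    Arc    : Vertex → Vertex → Set

  -- adjacency in the underlying undirected graph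
  Adjacent : Vertex → Vertex → Set
  Adjacent u v = Arc u v ⊎ Arc v u

Colourable : Digraph → ℕ → Set
Colourable G n = Σ (Vertex → Fin n) λ c → ∀ u v → Adjacent u v → c u ≢ c v
  where open Digraph G

IsChromaticNumber : Digraph → ℕ → Set
IsChromaticNumber G = IsLeast (Colourable G)

-- A = {y₁,…,y_k}
_IsImageOf_ : ∀ {N k} → Subset N → (Fin k → Fin N) → Set
A IsImageOf y = ∀ i → i ∈ A ⇔ (∃[ j ] y j ≡ i)

-- For an increasing sequence x of length k+1, x ∘ inject₁ is its first k
-- terms and x ∘ suc its last k terms.
Sh : ℕ → ℕ → Digraph
Sh N k = record
  { Vertex = KSubset N k
  ; Arc    = λ A B → Σ (Fin (suc k) → Fin N) λ x →
               x Preserves _<_ ⟶ _<_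
             × proj₁ A IsImageOf (λ j → x (inject₁ j))
             × proj₁ B IsImageOf (λ j → x (suc j))
  }

-- s = s₃(k), i.e. s = max {N ≥ 1 : χ(Sh(N,k)) ≤ 3}; meaningful for k ≥ 1,
-- where it exists by Ramsey's theorem.
IsShiftNumber₃ : (k s : ℕ) → Set
IsShiftNumber₃ k = IsGreatest λ N →
  1 ≤ N × (∃[ χ ] IsChromaticNumber (Sh N k) χ × χ ≤ 3)

{-# OPTIONS --safe #-}

-- Let c be a proper 3-colouring of Sh(N,t), where t = ⌊k/2⌋ - 2. Write a set as
-- an increasing sequence and record at each of its positions i whether c rises
-- from the t-window at i to the next one. As there are only three colours and
-- consecutive windows differ, three consecutive directions are never equal.
-- Colour a k-set by its first two directions (u, v) and its last two (w, z):
-- compare v with z if u = v, and with w otherwise. These directions only involve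
-- the first t + 2 and the last t + 2 elements, and k ≥ 2(t + 2). So if a
-- (k+1)-set has first directions u₀ u₁ u₂ and last directions w₀ w₁ w₂, then
-- deleting its last, its (t+3)-rd and its first element gives k-sets with the
-- data (u₀u₁, w₀w₁), (u₀u₁, w₁w₂) and (u₁u₂, w₁w₂), which never all get the
-- same colour.
module Submission where

open import Defs
open import Data.Nat using (ℕ; _+_; _∸_; _≤_; _>_; ⌊_/2⌋)

open import Data.Bool.Base using (Bool; true; false; not)
open import Data.Empty using (⊥)
open import Data.Fin.Base as Fin using (Fin; zero; suc; inject₁; inject≤; toℕ)
open import Data.Fin.Properties as Finₚ using (toℕ<n; inject≤-injective)
open import Data.Fin.Subset using (Subset; _∈_; _∉_; _⊆_; ∣_∣)
open import Data.Fin.Subset.Properties using (s⊆s; out⊆; ⊆-refl)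
open import Data.Nat.Base using (zero; suc; z≤n; s≤s; _<_; _≤′_; ≤′-refl; ≤′-step)
open import Data.Nat.Properties
open import Data.Product.Base using (Σ; _×_; _,_; proj₁; proj₂)
open import Data.Sum.Base using (inj₁; inj₂)
open import Data.Vec.Base using ([]; _∷_; here; there)
open import Function.Base using (_∘_)
open import Function.Bundles using (mk⇔; Equivalence)
open import Relation.Binary.Core using (_Preserves_⟶_)
open import Relation.Binary.PropositionalEquality
open import Relation.Nullary using (¬_; Dec; yes; no; does; contradiction)

private
  variable
    N n t : ℕ

-- Deletions and windows, indexed by rank.

-- The index is a rank within `A`, counted from 0, not a position in `Fin N`; from `∣ A ∣` on,
-- nothing is deleted.
deleteAt : ℕ → Subset N → Subset N
deleteAt m       []          = []
deleteAt m       (false ∷ A) = false ∷ deleteAt m A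
deleteAt zero    (true ∷ A)  = false ∷ A
deleteAt (suc m) (true ∷ A)  = true ∷ deleteAt m A

∣deleteAt∣ : ∀ m (A : Subset N) → m < ∣ A ∣ → suc ∣ deleteAt m A ∣ ≡ ∣ A ∣
∣deleteAt∣ m       (false ∷ A) m<       = ∣deleteAt∣ m A m<
∣deleteAt∣ zero    (true ∷ A)  m<       = refl
∣deleteAt∣ (suc m) (true ∷ A)  (s≤s m<) = cong suc (∣deleteAt∣ m A m<)

deleteAt-⊆ : ∀ m (A : Subset N) → deleteAt m A ⊆ A
deleteAt-⊆ m       []          = ⊆-refl
deleteAt-⊆ m       (false ∷ A) = s⊆s (deleteAt-⊆ m A)
deleteAt-⊆ zero    (true ∷ A)  = out⊆ ⊆-refl
deleteAt-⊆ (suc m) (true ∷ A)  = s⊆s (deleteAt-⊆ m A)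

-- The elements of A of ranks i, …, i + t - 1, counted from 0; fewer if A runs out.
window : (i t : ℕ) → Subset N → Subset N
window i       t       []          = []
window i       t       (false ∷ A) = false ∷ window i t A
window (suc i) t       (true ∷ A)  = false ∷ window i t A
window zero    zero    (true ∷ A)  = false ∷ window zero zero A
window zero    (suc t) (true ∷ A)  = true ∷ window zero t A

∣window∣ : ∀ i t (A : Subset N) → i + t ≤ ∣ A ∣ → ∣ window i t A ∣ ≡ t
∣window∣ zero    zero    []          _       = refl
∣window∣ i       t       (false ∷ A) h       = ∣window∣ i t A h
∣window∣ (suc i) t       (true ∷ A)  (s≤s h) = ∣window∣ i t A h
∣window∣ zero    zero    (true ∷ A)  h       = ∣window∣ zero zero A z≤n
∣window∣ zero    (suc t) (true ∷ A)  (s≤s h) = cong suc (∣window∣ zero t A h)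

-- Ranks below `m` survive the deletion, and the window only uses ranks below `i + t`.
window-deleteAt-before : ∀ {m} i t (A : Subset N) → i + t ≤ m →
                         window i t (deleteAt m A) ≡ window i t A
window-deleteAt-before i       t       []          h       = refl
window-deleteAt-before i       t       (false ∷ A) h       =
  cong (false ∷_) (window-deleteAt-before i t A h)
window-deleteAt-before (suc i) t       (true ∷ A)  (s≤s h) =
  cong (false ∷_) (window-deleteAt-before i t A h)
window-deleteAt-before {m = zero}  zero zero    (true ∷ A) h = refl
window-deleteAt-before {m = suc m} zero zero    (true ∷ A) h =
  cong (false ∷_) (window-deleteAt-before zero zero A z≤n)
window-deleteAt-before zero    (suc t) (true ∷ A)  (s≤s h) =
  cong (true ∷_) (window-deleteAt-before zero t A h)

-- The deletion lowers every rank above `m` by one.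
window-deleteAt-after : ∀ {m} i t (A : Subset N) → m ≤ i →
                        window i t (deleteAt m A) ≡ window (suc i) t A
window-deleteAt-after i       t []          h       = refl
window-deleteAt-after i       t (false ∷ A) h       =
  cong (false ∷_) (window-deleteAt-after i t A h)
window-deleteAt-after i       t (true ∷ A)  z≤n     = refl
window-deleteAt-after (suc i) t (true ∷ A)  (s≤s h) =
  cong (false ∷_) (window-deleteAt-after i t A h)

-- Consecutive windows as arcs of the shift graph.

Increasing : (Fin n → Fin N) → Set
Increasing x = x Preserves Fin._<_ ⟶ Fin._<_

image-suc : ∀ {A : Subset N} {y : Fin n → Fin N} →
            A IsImageOf y → (false ∷ A) IsImageOf (suc ∘ y)
image-suc A≈y zero    = mk⇔ (λ ()) (λ ())
image-suc A≈y (suc i) = mk⇔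
  (λ { (there i∈A) → let j , yj≡i = to i∈A in j , cong suc yj≡i })
  (λ { (j , refl) → there (from (j , refl)) })
  where open Equivalence (A≈y i)

-- The pointwise hypotheses on x spare function extensionality.
image-cons : ∀ {A : Subset N} {y : Fin n → Fin N} {x : Fin (suc n) → Fin (suc N)} →
             A IsImageOf y → x zero ≡ zero → (∀ j → x (suc j) ≡ suc (y j)) →
             (true ∷ A) IsImageOf x
image-cons A≈y x₀ xₛ zero    = mk⇔ (λ _ → zero , x₀) (λ _ → here)
image-cons {A = A} {y} {x} A≈y x₀ xₛ (suc i) = mk⇔ ⇒ ⇐
  where
  open Equivalence (A≈y i)
  ⇒ : suc i ∈ true ∷ A → Σ _ λ j → x j ≡ suc i
  ⇒ (there i∈A) = let j , yj≡i = to i∈A in suc j , trans (xₛ j) (cong suc yj≡i)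
  ⇐ : (Σ _ λ j → x j ≡ suc i) → suc i ∈ true ∷ A
  ⇐ (zero , eq)  = contradiction (trans (sym x₀) eq) λ ()
  ⇐ (suc j , eq) = there (from (j , Finₚ.suc-injective (trans (sym (xₛ j)) eq)))

∉window₀₀ : ∀ (A : Subset N) {i} → i ∉ window zero zero A
∉window₀₀ (false ∷ A) (there i∈) = ∉window₀₀ A i∈
∉window₀₀ (true ∷ A)  (there i∈) = ∉window₀₀ A i∈

image-empty : ∀ (A : Subset N) {y : Fin 0 → Fin N} → window zero zero A IsImageOf y
image-empty A i = mk⇔ (λ i∈ → contradiction i∈ (∉window₀₀ A)) (λ ())

cons : (Fin n → Fin N) → Fin (suc n) → Fin (suc N)
cons y zero    = zero
cons y (suc j) = suc (y j)

cons-increasing : ∀ {y : Fin n → Fin N} → Increasing y → Increasing (cons y)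
cons-increasing inc {zero}  {suc j} _       = s≤s z≤n
cons-increasing inc {suc i} {suc j} (s≤s h) = s≤s (inc h)

-- A single `x` serves both windows because `window-arc` puts one element in front of it: the
-- shorter window then completes the source of the arc, the longer one is its target.
initial-enumeration : ∀ t (A : Subset N) → suc t ≤ ∣ A ∣ →
  Σ (Fin (suc t) → Fin N) λ x → Increasing x ×
    window zero t A IsImageOf (x ∘ inject₁) × window zero (suc t) A IsImageOf x
initial-enumeration t (false ∷ A) h =
  let x , inc , l , r = initial-enumeration t A h
  in suc ∘ x , s≤s ∘ inc , image-suc l , image-suc r
initial-enumeration zero (true ∷ A) h =
  cons (λ ()) , cons-increasing (λ { {()} }) ,
  image-empty (true ∷ A) ,
  image-cons {y = λ ()} (image-empty A) refl (λ ())
initial-enumeration (suc t) (true ∷ A) (s≤s h) =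
  let x , inc , l , r = initial-enumeration t A h
  in cons x , cons-increasing inc ,
     image-cons l refl (λ _ → refl) , image-cons r refl (λ _ → refl)

window-arc : ∀ i t (A : Subset N) → i + t < ∣ A ∣ →
  Σ (Fin (suc t) → Fin N) λ x → Increasing x ×
    window i t A IsImageOf (x ∘ inject₁) × window (suc i) t A IsImageOf (x ∘ suc)
window-arc i t (false ∷ A) h =
  let x , inc , l , r = window-arc i t A h
  in suc ∘ x , s≤s ∘ inc , image-suc l , image-suc r
window-arc (suc i) t (true ∷ A) (s≤s h) =
  let x , inc , l , r = window-arc i t A h
  in suc ∘ x , s≤s ∘ inc , image-suc l , image-suc r
window-arc zero zero (true ∷ A) h =
  cons (λ ()) , cons-increasing (λ { {()} }) ,
  image-empty (true ∷ A) , image-empty (false ∷ A)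
window-arc zero (suc t) (true ∷ A) (s≤s h) =
  let x , inc , l , r = initial-enumeration t A h
  in cons x , cons-increasing inc , image-cons l refl (λ _ → refl) , image-suc r

-- Directions in three colours, and the colour pattern.

NotAllEqual : (a b c : Bool) → Set
NotAllEqual a b c = ¬ (a ≡ b × b ≡ c)

rises : Fin 3 → Fin 3 → Bool
rises a b = does (a Finₚ.<? b)

no-long-chain : ∀ {a b c d : Fin 3} → a Fin.< b → b Fin.< c → c Fin.< d → ⊥
no-long-chain {d = d} a<b b<c c<d
  -- The composite inequality reads `4 + toℕ a ≤ 3`.
  with ≤-trans (s≤s (≤-trans (s≤s (≤-trans (s≤s a<b) b<c)) c<d)) (toℕ<n d)
... | s≤s (s≤s (s≤s ()))

-- Between distinct colours a non-rise is a fall, so three equal directions would give a strict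
-- chain of four elements in `Fin 3`.
rises-notAllEqual : ∀ {a b c d} → a ≢ b → b ≢ c → c ≢ d →
                    NotAllEqual (rises a b) (rises b c) (rises c d)
rises-notAllEqual {a} {b} {c} {d} a≢b b≢c c≢d =
  cases (a Finₚ.<? b) (b Finₚ.<? c) (c Finₚ.<? d)
  where
  flip : ∀ {x y : Fin 3} → x ≢ y → ¬ (x Fin.< y) → y Fin.< x
  flip x≢y x≮y = ≤∧≢⇒< (≮⇒≥ x≮y) (x≢y ∘ sym ∘ Finₚ.toℕ-injective)
  cases : (p : Dec (a Fin.< b)) (q : Dec (b Fin.< c)) (r : Dec (c Fin.< d)) →
          NotAllEqual (does p) (does q) (does r)
  cases (yes a<b) (yes b<c) (yes c<d) _ = no-long-chain a<b b<c c<d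
  cases (no  a≮b) (no  b≮c) (no  c≮d) _ =
    no-long-chain (flip c≢d c≮d) (flip b≢c b≮c) (flip a≢b a≮b)
  cases (yes _) (yes _) (no  _) (_ , ())
  cases (yes _) (no  _) _       (() , _)
  cases (no  _) (yes _) _       (() , _)
  cases (no  _) (no  _) (yes _) (_ , ())

paint : Bool → Colour
paint true  = red
paint false = blue

paint-injective : ∀ {a b} → paint a ≡ paint b → a ≡ b
paint-injective {true}  {true}  _ = refl
paint-injective {false} {false} _ = refl

paint-not : ∀ {a} → paint a ≢ paint (not a)
paint-not {true}  ()
paint-not {false} ()

paint-not-injective : ∀ {a b} → paint (not a) ≡ paint (not b) → a ≡ b
paint-not-injective {true}  {true}  _ = refl
paint-not-injective {false} {false} _ = refl

-- Red stands for agreement of the two compared directions, blue for disagreement.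
pattern-colour : (u v w z : Bool) → Colour
pattern-colour true  true  w z = paint z
pattern-colour false false w z = paint (not z)
pattern-colour true  false w z = paint (not w)
pattern-colour false true  w z = paint w

-- If `u₁ ≢ u₂`, the third pattern compares `u₂` with `w₁`, while the first (if `u₀ ≡ u₁`) or the
-- second (otherwise) compares `u₁` with `w₁`; these two disagree. If `u₁ ≡ u₂`, then `u₀ ≢ u₁`, and
-- the patterns compare one and the same value with `w₀`, `w₁` and `w₂`, which are not all equal.
pattern-colour-splits : ∀ {u₀ u₁ u₂ w₀ w₁ w₂} →
  NotAllEqual u₀ u₁ u₂ → NotAllEqual w₀ w₁ w₂ → ∀ {col} →
  pattern-colour u₀ u₁ w₀ w₁ ≡ col → pattern-colour u₀ u₁ w₁ w₂ ≡ col →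
  pattern-colour u₁ u₂ w₁ w₂ ≢ col
pattern-colour-splits {true}  {true}  {true}  u w p q r = u (refl , refl)
pattern-colour-splits {false} {false} {false} u w p q r = u (refl , refl)
pattern-colour-splits {true}  {true}  {false} u w p q r = paint-not (trans p (sym r))
pattern-colour-splits {false} {false} {true}  u w p q r = paint-not (trans r (sym p))
pattern-colour-splits {true}  {false} {true}  u w p q r = paint-not (trans r (sym q))
pattern-colour-splits {false} {true}  {false} u w p q r = paint-not (trans q (sym r))
pattern-colour-splits {true}  {false} {false} u w p q r =
  w (paint-not-injective (trans p (sym q)) , paint-not-injective (trans q (sym r)))
pattern-colour-splits {false} {true}  {true}  u w p q r =
  w (paint-injective (trans p (sym q)) , paint-injective (trans q (sym r)))

-- Unlike c, the extension does not depend on a proof of the cardinality, so it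
-- respects equality of subsets; off the vertices its value is junk.
extend : (KSubset N t → Fin 3) → Subset N → Fin 3
extend {t = t} c A with ∣ A ∣ ≟ t
... | yes ∣A∣≡t = c (A , ∣A∣≡t)
... | no  _     = zero

-- The cardinality proof is returned rather than prescribed: properness of a colouring applies to
-- any such proof, so none has to be compared with `h`.
extend-vertex : ∀ (c : KSubset N t → Fin 3) {A} → ∣ A ∣ ≡ t →
                Σ (∣ A ∣ ≡ t) λ eq → extend c A ≡ c (A , eq)
extend-vertex {t = t} c {A} h with ∣ A ∣ ≟ t
... | yes eq = eq , refl
... | no  ¬eq = contradiction h ¬eq

-- The red/blue colouring induced by a 3-colouring of the shift graph.

module _ {N t : ℕ} (colouring : Colourable (Sh N t) 3) where

  private
    c      = proj₁ colouring
    proper = proj₂ colouring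

  direction : ℕ → Subset N → Bool
  direction i A = rises (extend c (window i t A)) (extend c (window (suc i) t A))

  consecutive-windows : ∀ i A → suc i + t ≤ ∣ A ∣ →
    extend c (window i t A) ≢ extend c (window (suc i) t A)
  consecutive-windows i A h eq =
    let p , c≡p = extend-vertex c (∣window∣ i t A (≤-trans (n≤1+n _) h))
        q , c≡q = extend-vertex c (∣window∣ (suc i) t A h)
    in proper (_ , p) (_ , q) (inj₁ (window-arc i t A h))
         (trans (sym c≡p) (trans eq c≡q))

  directions-notAllEqual : ∀ i A → 3 + i + t ≤ ∣ A ∣ →
    NotAllEqual (direction i A) (direction (1 + i) A) (direction (2 + i) A)
  directions-notAllEqual i A h = rises-notAllEqual
    (consecutive-windows i A (≤-trans (n≤1+n _) (≤-trans (n≤1+n _) h)))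
    (consecutive-windows (1 + i) A (≤-trans (n≤1+n _) h))
    (consecutive-windows (2 + i) A h)

  direction-before : ∀ {m} i A → suc i + t ≤ m →
                     direction i (deleteAt m A) ≡ direction i A
  direction-before i A h = cong₂ (λ B C → rises (extend c B) (extend c C))
    (window-deleteAt-before i t A (≤-trans (n≤1+n _) h))
    (window-deleteAt-before (suc i) t A h)

  direction-after : ∀ {m} i A → m ≤ i →
                    direction i (deleteAt m A) ≡ direction (suc i) A
  direction-after i A h = cong₂ (λ B C → rises (extend c B) (extend c C))
    (window-deleteAt-after i t A h)
    (window-deleteAt-after (suc i) t A (m≤n⇒m≤1+n h))

  -- Here p is the rank at which the last t + 2 elements of a (p + t + 2)-set begin.
  colour : ℕ → Subset N → Colour
  colour p A =
    pattern-colour (direction 0 A) (direction 1 A) (direction p A) (direction (1 + p) A)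

  module _ (p : ℕ) (2+t≤p : 2 + t ≤ p) (A : Subset N) (∣A∣ : ∣ A ∣ ≡ 3 + p + t) where

    colour-delete-last : colour p (deleteAt (2 + p + t) A) ≡ colour p A
    colour-delete-last
      rewrite direction-before 0 A (s≤s (m≤n+m t (1 + p)))
            | direction-before 1 A (s≤s (s≤s (m≤n+m t p)))
            | direction-before p A (n≤1+n (1 + p + t))
            | direction-before (1 + p) A (≤-refl {2 + p + t}) = refl

    -- Directions 0 and 1 use only ranks below `2 + t` and are kept; since `2 + t ≤ p`, directions
    -- `p` and `1 + p` both move up by one.
    colour-delete-middle : colour p (deleteAt (2 + t) A) ≡
      pattern-colour (direction 0 A) (direction 1 A) (direction (1 + p) A) (direction (2 + p) A)
    colour-delete-middle
      rewrite direction-before 0 A (n≤1+n (1 + t))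
            | direction-before 1 A (≤-refl {2 + t})
            | direction-after p A 2+t≤p
            | direction-after (1 + p) A (m≤n⇒m≤1+n 2+t≤p) = refl

    colour-delete-first : colour p (deleteAt 0 A) ≡
      pattern-colour (direction 1 A) (direction 2 A) (direction (1 + p) A) (direction (2 + p) A)
    colour-delete-first
      rewrite direction-after 0 A z≤n
            | direction-after 1 A z≤n
            | direction-after p A z≤n
            | direction-after (1 + p) A z≤n = refl

    not-monochromatic : ∀ col →
      ¬ Monochromatic {N} {2 + p + t} (colour p ∘ proj₁) col A
    not-monochromatic col mono = pattern-colour-splits
      (directions-notAllEqual 0 A (≤-trans (+-monoʳ-≤ 3 (m≤n+m t p)) (≤-reflexive (sym ∣A∣))))
      (directions-notAllEqual p A (≤-reflexive (sym ∣A∣)))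
      (trans (sym colour-delete-last) (deleted (2 + p + t) ≤-refl))
      (trans (sym colour-delete-middle) (deleted (2 + t) (+-monoʳ-≤ 3 (m≤n+m t p))))
      (trans (sym colour-delete-first) (deleted 0 (s≤s z≤n)))
      where
      deleted : ∀ m → m < 3 + p + t → colour p (deleteAt m A) ≡ col
      deleted m m< = mono
        (deleteAt m A , suc-injective (trans (∣deleteAt∣ m A (subst (m <_) (sym ∣A∣) m<)) ∣A∣))
        (deleteAt-⊆ m A)

¬ramsey : ∀ p → 2 + t ≤ p → Colourable (Sh N t) 3 →
          ¬ RamseyProperty (2 + p + t) (3 + p + t) (3 + p + t) N
¬ramsey p h col ramsey with ramsey (colour col p ∘ proj₁)
... | inj₁ (A , ∣A∣ , mono) = not-monochromatic col p h A ∣A∣ red mono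
... | inj₂ (A , ∣A∣ , mono) = not-monochromatic col p h A ∣A∣ blue mono

-- Monotonicity of colourability, and the conclusion.

colourable-inject : ∀ {G m} → m ≤ n → Colourable G m → Colourable G n
colourable-inject m≤n (c , proper) =
  (λ v → inject≤ (c v) m≤n) ,
  λ u v adj eq → proper u v adj (inject≤-injective m≤n m≤n _ _ eq)

-- `Sh N t` embeds in `Sh (suc N) t` as the sets avoiding `zero`. Prefixing `false` leaves the
-- cardinality unchanged by computation.
colourable-pred : Colourable (Sh (suc N) t) n → Colourable (Sh N t) n
colourable-pred {N} {t} (c , proper) = c ∘ shift , λ u v → proper (shift u) (shift v) ∘ adjacent u v
  where
  open Digraph
  shift : KSubset N t → KSubset (suc N) t
  shift (A , ∣A∣) = false ∷ A , ∣A∣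
  arc : ∀ u v → Arc (Sh N t) u v → Arc (Sh (suc N) t) (shift u) (shift v)
  arc u v (x , inc , l , r) = suc ∘ x , s≤s ∘ inc , image-suc l , image-suc r
  adjacent : ∀ u v → Adjacent (Sh N t) u v → Adjacent (Sh (suc N) t) (shift u) (shift v)
  adjacent u v (inj₁ a) = inj₁ (arc u v a)
  adjacent u v (inj₂ a) = inj₂ (arc v u a)

colourable-≤′ : ∀ {M} → M ≤′ N → Colourable (Sh N t) n → Colourable (Sh M t) n
colourable-≤′ ≤′-refl       = λ col → col
colourable-≤′ (≤′-step M≤N) = colourable-≤′ M≤N ∘ colourable-pred

⌊n/2⌋+⌊n/2⌋≤n : ∀ n → ⌊ n /2⌋ + ⌊ n /2⌋ ≤ n
⌊n/2⌋+⌊n/2⌋≤n n = ≤-trans (+-monoʳ-≤ ⌊ n /2⌋ (⌊n/2⌋≤⌈n/2⌉ n)) (≤-reflexive (⌊n/2⌋+⌈n/2⌉≡n n))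

theorem1p2 : (k : ℕ) → 6 ≤ k → (r s : ℕ) →
    IsRamseyNumber k (k + 1) (k + 1) r →
    IsShiftNumber₃ (⌊ k /2⌋ ∸ 2) s →
    r > s
-- If `r ≤ s`, the 3-colouring at `s` restricts to `r` and refutes the Ramsey property there.
theorem1p2 k 6≤k r s (ramsey , _) ((_ , χ , (col , _) , χ≤3) , _) = ≰⇒> λ r≤s →
  ¬ramsey p 2+t≤p (colourable-≤′ (≤⇒≤′ r≤s) (colourable-inject χ≤3 col))
    (subst (λ j → RamseyProperty j (suc j) (suc j) r) (sym 2+p+t≡k)
      (subst (λ j → RamseyProperty k j j r) (+-comm k 1) ramsey))
  where
  half = ⌊ k /2⌋
  t′ = half ∸ 2
  -- Chosen so that `2 + p + t′` is `k`; it is at least `half`, which keeps the two ends of a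
  -- `k`-set disjoint.
  p = k ∸ half
  2+t≡half : 2 + t′ ≡ half
  -- From `6 ≤ k` comes `3 ≤ half`, so the subtraction in `half ∸ 2` is not truncated.
  2+t≡half = m+[n∸m]≡n (≤-trans (n≤1+n 2) (⌊n/2⌋-mono 6≤k))
  2+t≤p : 2 + t′ ≤ p
  2+t≤p = ≤-trans (≤-reflexive 2+t≡half) (m+n≤o⇒m≤o∸n half (⌊n/2⌋+⌊n/2⌋≤n k))
  2+p+t≡k : 2 + p + t′ ≡ k
  2+p+t≡k = begin
    2 + (p + t′) ≡⟨ cong (2 +_) (+-comm p t′) ⟩
    2 + t′ + p   ≡⟨ cong (_+ p) 2+t≡half ⟩
    half + p    ≡⟨ m+[n∸m]≡n (⌊n/2⌋≤n k) ⟩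
    k           ∎
    where open ≡-Reasoning
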